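{- Let $l$ be a positive integer and let $\alpha,\beta,\gamma,\alpha',\beta',\gamma'$ be real numbers such that $\alpha\ge 0$, $\alpha'\ge 0$, $\beta\ge 0$, $-\alpha'\le \beta'\le 0$, $\alpha+\beta+\gamma\ge 0$ and $\alpha'+\beta'+\gamma'\ge 0$. Let $T(n,k)$ be defined by $T(1,1)=1$, $T(n,k)=0$ unless $1\le k\le n$, and $$T(n,k)=(\alpha n+\beta k+\gamma)^l\,T(n-1,k)+(\alpha' n+\beta' k+\gamma')^l\,T(n-1,k-1)\qquad(n\ge 2,\ 1\le k\le n).$$ Then for every $n\ge 1$ the sequence $(T(n,k))_k$ is log-concave in $k$, i.e. $T(n,k)^2\ge T(n,k-1)T(n,k+1)$ for all $k$. -}

module Defs where

open import Data.Bool.Base using (if_then_else_)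
open import Data.Integer.Base as ℤ using (ℤ; 1ℤ)
import Data.Integer.Properties as ℤ
open import Data.Nat.Base as ℕ using (ℕ; zero; suc)
import Data.Nat.Properties as ℕ
open import Data.Product.Base using (_×_; _,_; ∃-syntax)
open import Data.Rational.Base as ℚ using (ℚ; 0ℚ; 1ℚ; ½; ∣_∣; 1/_; Positive)
import Data.Rational.Properties as ℚ
open import Data.Rational.Solver using (module +-*-Solver)
open import Relation.Binary.PropositionalEquality using (_≡_; refl; sym; trans; cong; subst)
open import Relation.Nullary.Decidable using (⌊_⌋; _×-dec_)

infixl 6 _+_
infixl 7 _*_
infix  8 -_
infixr 8 _^_
infix  4 _≤_ _≃_

-- The real numbers, as Cauchy sequences of rationals.  Equality of reals is
-- the setoid relation _≃_ below.

IsCauchy : (ℕ → ℚ) → Set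
IsCauchy x = ∀ ε → 0ℚ ℚ.< ε →
  ∃[ N ] ∀ m n → N ℕ.≤ m → N ℕ.≤ n → ∣ x m ℚ.- x n ∣ ℚ.< ε

record ℝ : Set where
  constructor mkℝ
  field
    seq    : ℕ → ℚ
    cauchy : IsCauchy seq

open ℝ public

_≤_ : ℝ → ℝ → Set
x ≤ y = ∀ ε → 0ℚ ℚ.< ε → ∃[ N ] ∀ n → N ℕ.≤ n → seq x n ℚ.≤ seq y n ℚ.+ ε

_≃_ : ℝ → ℝ → Set
x ≃ y = x ≤ y × y ≤ x

private
  abstract
    ½ε>0 : ∀ {ε} → 0ℚ ℚ.< ε → 0ℚ ℚ.< ½ ℚ.* ε
    ½ε>0 {ε} ε>0 = ℚ.positive⁻¹ (½ ℚ.* ε) {{ℚ.pos*pos⇒pos ½ ε {{ℚ.positive ε>0}}}}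

    ½ε+½ε≡ε : ∀ ε → ½ ℚ.* ε ℚ.+ ½ ℚ.* ε ≡ ε
    ½ε+½ε≡ε ε = trans (sym (ℚ.*-distribʳ-+ ε ½ ½)) (ℚ.*-identityˡ ε)

    const-cauchy : ∀ q → IsCauchy (λ _ → q)
    const-cauchy q ε ε>0 =
      0 , λ _ _ _ _ → subst (ℚ._< ε) (sym (cong ∣_∣ (ℚ.+-inverseʳ q))) ε>0

    +-cauchy : ∀ x y → IsCauchy x → IsCauchy y → IsCauchy (λ n → x n ℚ.+ y n)
    +-cauchy x y cx cy ε ε>0 with cx (½ ℚ.* ε) (½ε>0 ε>0) | cy (½ ℚ.* ε) (½ε>0 ε>0)
    ... | M , p | N , q = M ℕ.⊔ N , λ m n ≤m ≤n → begin-strict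
      ∣ (x m ℚ.+ y m) ℚ.- (x n ℚ.+ y n) ∣
        ≡⟨ cong ∣_∣ (solve 4 (λ a b c d → (a :+ b) :- (c :+ d) := (a :- c) :+ (b :- d)) refl (x m) (y m) (x n) (y n)) ⟩
      ∣ (x m ℚ.- x n) ℚ.+ (y m ℚ.- y n) ∣
        ≤⟨ ℚ.∣p+q∣≤∣p∣+∣q∣ (x m ℚ.- x n) (y m ℚ.- y n) ⟩
      ∣ x m ℚ.- x n ∣ ℚ.+ ∣ y m ℚ.- y n ∣
        <⟨ ℚ.+-mono-< (p m n (ℕ.m⊔n≤o⇒m≤o M N ≤m) (ℕ.m⊔n≤o⇒m≤o M N ≤n))
                      (q m n (ℕ.m⊔n≤o⇒n≤o M N ≤m) (ℕ.m⊔n≤o⇒n≤o M N ≤n)) ⟩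
      ½ ℚ.* ε ℚ.+ ½ ℚ.* ε
        ≡⟨ ½ε+½ε≡ε ε ⟩
      ε ∎
      where
      open ℚ.≤-Reasoning
      open +-*-Solver

    neg-cauchy : ∀ x → IsCauchy x → IsCauchy (λ n → ℚ.- x n)
    neg-cauchy x cx ε ε>0 with cx ε ε>0
    ... | N , p = N , λ m n ≤m ≤n → subst (ℚ._< ε) (sym (eq m n)) (p m n ≤m ≤n)
      where
      open +-*-Solver
      eq : ∀ m n → ∣ (ℚ.- x m) ℚ.- (ℚ.- x n) ∣ ≡ ∣ x m ℚ.- x n ∣
      eq m n = trans
        (cong ∣_∣ (solve 2 (λ a b → (:- a) :- (:- b) := :- (a :- b)) refl (x m) (x n)))
        (ℚ.∣-p∣≡∣p∣ (x m ℚ.- x n))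

    eventually-bounded : ∀ x → IsCauchy x →
      ∃[ B ] Positive B × ∃[ N ] ∀ n → N ℕ.≤ n → ∣ x n ∣ ℚ.≤ B
    eventually-bounded x cx with cx 1ℚ (ℚ.positive⁻¹ 1ℚ)
    ... | N , p = 1ℚ ℚ.+ ∣ x N ∣ , B>0 , N , λ n ≤n → begin
      ∣ x n ∣
        ≡⟨ cong ∣_∣ (solve 2 (λ a b → a := (a :- b) :+ b) refl (x n) (x N)) ⟩
      ∣ (x n ℚ.- x N) ℚ.+ x N ∣
        ≤⟨ ℚ.∣p+q∣≤∣p∣+∣q∣ (x n ℚ.- x N) (x N) ⟩
      ∣ x n ℚ.- x N ∣ ℚ.+ ∣ x N ∣
        ≤⟨ ℚ.+-monoˡ-≤ ∣ x N ∣ (ℚ.<⇒≤ (p n N ≤n ℕ.≤-refl)) ⟩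
      1ℚ ℚ.+ ∣ x N ∣ ∎
      where
      open ℚ.≤-Reasoning
      open +-*-Solver
      B>0 : Positive (1ℚ ℚ.+ ∣ x N ∣)
      B>0 = ℚ.pos+nonNeg⇒pos 1ℚ ∣ x N ∣ {{ℚ.nonNegative (ℚ.0≤∣p∣ (x N))}}

    *-small : ∀ a b B ε .{{_ : Positive B}} → ∣ a ∣ ℚ.≤ B → ∣ b ∣ ℚ.< ε →
      ∣ a ℚ.* b ∣ ℚ.< B ℚ.* ε
    *-small a b B ε a≤B b<ε = begin-strict
      ∣ a ℚ.* b ∣       ≡⟨ ℚ.∣p*q∣≡∣p∣*∣q∣ a b ⟩
      ∣ a ∣ ℚ.* ∣ b ∣   ≤⟨ ℚ.*-monoʳ-≤-nonNeg ∣ b ∣ {{ℚ.nonNegative (ℚ.0≤∣p∣ b)}} a≤B ⟩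
      B ℚ.* ∣ b ∣       <⟨ ℚ.*-monoʳ-<-pos B b<ε ⟩
      B ℚ.* ε           ∎
      where open ℚ.≤-Reasoning

    divide : ∀ C ε → Positive C → 0ℚ ℚ.< ε → ∃[ δ ] 0ℚ ℚ.< δ × C ℚ.* δ ≡ ε
    divide C ε C>0 ε>0 = δ , δ>0 , eq
      where
      instance
        C≢0 : ℚ.NonZero C
        C≢0 = ℚ.pos⇒nonZero C {{C>0}}
      δ : ℚ
      δ = 1/ C ℚ.* ε
      δ>0 : 0ℚ ℚ.< δ
      δ>0 = ℚ.positive⁻¹ δ
        {{ℚ.pos*pos⇒pos (1/ C) {{ℚ.1/pos⇒pos C {{C>0}}}} ε {{ℚ.positive ε>0}}}}
      eq : C ℚ.* δ ≡ ε
      eq = trans (sym (ℚ.*-assoc C (1/ C) ε))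
        (trans (cong (ℚ._* ε) (ℚ.*-inverseʳ C)) (ℚ.*-identityˡ ε))

    *-difference : ∀ a b c d →
      a ℚ.* b ℚ.- c ℚ.* d ≡ a ℚ.* (b ℚ.- d) ℚ.+ d ℚ.* (a ℚ.- c)
    *-difference = solve 4
      (λ a b c d → a :* b :- c :* d := a :* (b :- d) :+ d :* (a :- c)) refl
      where open +-*-Solver

    *-close : ∀ a b c d A B δ → Positive A → Positive B →
      ∣ a ∣ ℚ.≤ A → ∣ d ∣ ℚ.≤ B → ∣ a ℚ.- c ∣ ℚ.< δ → ∣ b ℚ.- d ∣ ℚ.< δ →
      ∣ a ℚ.* b ℚ.- c ℚ.* d ∣ ℚ.< (A ℚ.+ B) ℚ.* δ
    *-close a b c d A B δ A>0 B>0 a≤A d≤B a-c<δ b-d<δ =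
      subst (λ e → ∣ e ∣ ℚ.< (A ℚ.+ B) ℚ.* δ) (sym (*-difference a b c d))
        (subst (∣ u ℚ.+ v ∣ ℚ.<_) (sym (ℚ.*-distribʳ-+ δ A B))
          (ℚ.≤-<-trans (ℚ.∣p+q∣≤∣p∣+∣q∣ u v)
            (ℚ.+-mono-< {∣ u ∣} {A ℚ.* δ} {∣ v ∣} {B ℚ.* δ} u<Aδ v<Bδ)))
      where
      u v : ℚ
      u = a ℚ.* (b ℚ.- d)
      v = d ℚ.* (a ℚ.- c)
      u<Aδ : ∣ u ∣ ℚ.< A ℚ.* δ
      u<Aδ = *-small a (b ℚ.- d) A δ {{A>0}} a≤A b-d<δ
      v<Bδ : ∣ v ∣ ℚ.< B ℚ.* δ
      v<Bδ = *-small d (a ℚ.- c) B δ {{B>0}} d≤B a-c<δ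

    *-cauchy : ∀ x y → IsCauchy x → IsCauchy y → IsCauchy (λ n → x n ℚ.* y n)
    *-cauchy x y cx cy ε ε>0 =
      let A , A>0 , K , bx = eventually-bounded x cx
          B , B>0 , L , by = eventually-bounded y cy
          δ , δ>0 , Cδ≡ε   = divide (A ℚ.+ B) ε (ℚ.pos+pos⇒pos A {{A>0}} B {{B>0}}) ε>0
          M , p            = cx δ δ>0
          N , q            = cy δ δ>0
      in (K ℕ.⊔ L) ℕ.⊔ (M ℕ.⊔ N) , λ m n ≤m ≤n →
        let ≤mKL = ℕ.m⊔n≤o⇒m≤o (K ℕ.⊔ L) (M ℕ.⊔ N) ≤m
            ≤nKL = ℕ.m⊔n≤o⇒m≤o (K ℕ.⊔ L) (M ℕ.⊔ N) ≤n
            ≤mMN = ℕ.m⊔n≤o⇒n≤o (K ℕ.⊔ L) (M ℕ.⊔ N) ≤m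
            ≤nMN = ℕ.m⊔n≤o⇒n≤o (K ℕ.⊔ L) (M ℕ.⊔ N) ≤n
        in subst (∣ x m ℚ.* y m ℚ.- x n ℚ.* y n ∣ ℚ.<_) Cδ≡ε
          (*-close (x m) (y m) (x n) (y n) A B δ A>0 B>0
            (bx m (ℕ.m⊔n≤o⇒m≤o K L ≤mKL))
            (by n (ℕ.m⊔n≤o⇒n≤o K L ≤nKL))
            (p m n (ℕ.m⊔n≤o⇒m≤o M N ≤mMN) (ℕ.m⊔n≤o⇒m≤o M N ≤nMN))
            (q m n (ℕ.m⊔n≤o⇒n≤o M N ≤mMN) (ℕ.m⊔n≤o⇒n≤o M N ≤nMN)))

fromℚ : ℚ → ℝ
fromℚ q = mkℝ (λ _ → q) (const-cauchy q)

fromℤ : ℤ → ℝ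
fromℤ k = fromℚ (k ℚ./ 1)

0ℝ 1ℝ : ℝ
0ℝ = fromℚ 0ℚ
1ℝ = fromℚ 1ℚ

_+_ : ℝ → ℝ → ℝ
x + y = mkℝ (λ n → seq x n ℚ.+ seq y n) (+-cauchy (seq x) (seq y) (cauchy x) (cauchy y))

_*_ : ℝ → ℝ → ℝ
x * y = mkℝ (λ n → seq x n ℚ.* seq y n) (*-cauchy (seq x) (seq y) (cauchy x) (cauchy y))

-_ : ℝ → ℝ
- x = mkℝ (λ n → ℚ.- seq x n) (neg-cauchy (seq x) (cauchy x))

_^_ : ℝ → ℕ → ℝ
x ^ zero  = 1ℝ
x ^ suc l = x * x ^ l

-- The column index k ranges over all integers, so that k - 1 and k + 1 always
-- make sense; entries outside 1 ≤ k ≤ n (in particular the row n = 0) are zero.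

T : ℕ → (α β γ α′ β′ γ′ : ℝ) → ℕ → ℤ → ℝ
T l α β γ α′ β′ γ′ zero            k = 0ℝ
T l α β γ α′ β′ γ′ (suc zero)      k = if ⌊ k ℤ.≟ 1ℤ ⌋ then 1ℝ else 0ℝ
T l α β γ α′ β′ γ′ n@(suc m@(suc _)) k =
  if ⌊ (1ℤ ℤ.≤? k) ×-dec (k ℤ.≤? ℤ.+ n) ⌋
  then (α * fromℤ (ℤ.+ n) + β * fromℤ k + γ) ^ l * T l α β γ α′ β′ γ′ m k
     + (α′ * fromℤ (ℤ.+ n) + β′ * fromℤ k + γ′) ^ l * T l α β γ α′ β′ γ′ m (k ℤ.- 1ℤ)
  else 0ℝ

LogConcave : (ℤ → ℝ) → Set
LogConcave a = ∀ k → a (k ℤ.- 1ℤ) * a (k ℤ.+ 1ℤ) ≤ a k ^ 2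

{-# OPTIONS --safe #-}
-- T(n,k) is a sum over lattice paths from (1,1) to (n,k) of the l-th power of a
-- product of linear step weights.  Given a path p to (n,k-1) and a path q to
-- (n,k+1), exchange their tails, shifted by one column, after the last time q
-- is one column above p.  This is an injection into pairs of paths to (n,k),
-- and it does not decrease the weight: the only steps that lose weight are those
-- where p goes up and q does not (so the distance shrinks), and each of them is
-- matched, like parentheses, with an earlier step where the distance grows.  The
-- matched steps together gain, since (a + β)(a' - β) ≥ a a' when a' - a ≥ β.
-- Summed over all pairs of paths, with the steps read from the last one and the
-- unmatched losses collected in a list L, this becomes the induction on n for
--   T(n,i) T(n,j+2) old(L) ≤ T(n,i+1) T(n,j+1) new(L),   j = length L + i.
module Submission where

open import Defs
open import Data.Bool.Base using (if_then_else_)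
open import Data.Integer.Base as ℤ using (ℤ; +_; -[1+_]; 1ℤ)
import Data.Integer.Properties as ℤ
open import Data.List.Base using (List; []; _∷_; length)
open import Data.List.Relation.Unary.All as All using (All; []; _∷_)
open import Data.Nat.Base as ℕ using (ℕ; zero; suc; z≤n; s≤s)
import Data.Nat.Properties as ℕ
open import Data.Nat.Solver using () renaming (module +-*-Solver to ℕ-Solver)
open import Data.Product.Base using (_×_; _,_; proj₁; proj₂; ∃-syntax)
open import Data.Rational.Base as ℚ using (ℚ; 0ℚ; 1ℚ; ½; 1/_; ∣_∣; Positive)
import Data.Rational.Properties as ℚ
open import Data.Rational.Solver using (module +-*-Solver)
import Data.Rational.Unnormalised.Base as ℚᵘ
import Data.Rational.Unnormalised.Properties as ℚᵘ
open import Data.Sum.Base using (inj₁; inj₂)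
open import Relation.Binary.PropositionalEquality
open import Relation.Nullary using (¬_; Dec; yes; no; contradiction)
open import Relation.Nullary.Decidable using (⌊_⌋; _×-dec_)

-- The order on ℝ

infix 4 _≲_

-- Unlike _≤_, which unfolds to a Π-type, this wrapper lets Agda infer the
-- two reals from the type of an inequality.
record _≲_ (x y : ℝ) : Set where
  constructor wrap
  field unwrap : x ≤ y

open _≲_

½ε>0 : ∀ {ε} → 0ℚ ℚ.< ε → 0ℚ ℚ.< ½ ℚ.* ε
½ε>0 {ε} ε>0 = ℚ.positive⁻¹ (½ ℚ.* ε) {{ℚ.pos*pos⇒pos ½ ε {{ℚ.positive ε>0}}}}

½ε+½ε≡ε : ∀ ε → ½ ℚ.* ε ℚ.+ ½ ℚ.* ε ≡ ε
½ε+½ε≡ε ε = trans (sym (ℚ.*-distribʳ-+ ε ½ ½)) (ℚ.*-identityˡ ε)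

pointwise-≲ : ∀ {x y} → (∀ n → seq x n ℚ.≤ seq y n) → x ≲ y
pointwise-≲ {x} {y} x≤y = wrap λ ε ε>0 → 0 , λ n _ →
  ℚ.≤-trans (x≤y n) (ℚ.≤-trans (ℚ.≤-reflexive (sym (ℚ.+-identityʳ (seq y n))))
                               (ℚ.+-monoʳ-≤ (seq y n) (ℚ.<⇒≤ ε>0)))

≈⇒≲ : ∀ {x y} → (∀ n → seq x n ≡ seq y n) → x ≲ y
≈⇒≲ x≈y = pointwise-≲ λ n → ℚ.≤-reflexive (x≈y n)

≲-refl : ∀ {x} → x ≲ x
≲-refl = ≈⇒≲ λ _ → refl

≲-reflexive : ∀ {x y} → x ≡ y → x ≲ y
≲-reflexive refl = ≲-refl

≲-trans : ∀ {x y z} → x ≲ y → y ≲ z → x ≲ z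
≲-trans {x} {y} {z} (wrap x≤y) (wrap y≤z) = wrap λ ε ε>0 →
  let M , p = x≤y (½ ℚ.* ε) (½ε>0 ε>0)
      N , q = y≤z (½ ℚ.* ε) (½ε>0 ε>0)
  in M ℕ.⊔ N , λ n ≤n → begin
    seq x n
      ≤⟨ p n (ℕ.m⊔n≤o⇒m≤o M N ≤n) ⟩
    seq y n ℚ.+ ½ ℚ.* ε
      ≤⟨ ℚ.+-monoˡ-≤ (½ ℚ.* ε) (q n (ℕ.m⊔n≤o⇒n≤o M N ≤n)) ⟩
    (seq z n ℚ.+ ½ ℚ.* ε) ℚ.+ ½ ℚ.* ε
      ≡⟨ ℚ.+-assoc (seq z n) (½ ℚ.* ε) (½ ℚ.* ε) ⟩
    seq z n ℚ.+ (½ ℚ.* ε ℚ.+ ½ ℚ.* ε)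
      ≡⟨ cong (seq z n ℚ.+_) (½ε+½ε≡ε ε) ⟩
    seq z n ℚ.+ ε ∎
  where open ℚ.≤-Reasoning

+-mono-≲ : ∀ {x y u v} → x ≲ y → u ≲ v → x + u ≲ y + v
+-mono-≲ {x} {y} {u} {v} (wrap x≤y) (wrap u≤v) = wrap λ ε ε>0 →
  let M , p = x≤y (½ ℚ.* ε) (½ε>0 ε>0)
      N , q = u≤v (½ ℚ.* ε) (½ε>0 ε>0)
  in M ℕ.⊔ N , λ n ≤n → begin
    seq x n ℚ.+ seq u n
      ≤⟨ ℚ.+-mono-≤ (p n (ℕ.m⊔n≤o⇒m≤o M N ≤n)) (q n (ℕ.m⊔n≤o⇒n≤o M N ≤n)) ⟩
    (seq y n ℚ.+ ½ ℚ.* ε) ℚ.+ (seq v n ℚ.+ ½ ℚ.* ε)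
      ≡⟨ solve 3 (λ a b c → (a :+ c) :+ (b :+ c) := (a :+ b) :+ (c :+ c)) refl
           (seq y n) (seq v n) (½ ℚ.* ε) ⟩
    (seq y n ℚ.+ seq v n) ℚ.+ (½ ℚ.* ε ℚ.+ ½ ℚ.* ε)
      ≡⟨ cong ((seq y n ℚ.+ seq v n) ℚ.+_) (½ε+½ε≡ε ε) ⟩
    (seq y n ℚ.+ seq v n) ℚ.+ ε ∎
  where
  open ℚ.≤-Reasoning
  open +-*-Solver

+-nonNeg : ∀ {x y} → 0ℝ ≲ x → 0ℝ ≲ y → 0ℝ ≲ x + y
+-nonNeg 0≲x 0≲y = ≲-trans (≈⇒≲ λ _ → refl) (+-mono-≲ 0≲x 0≲y)

-- Products and powers of non-negative reals.

eventually-bounded-above : ∀ x →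
  ∃[ B ] Positive B × ∃[ N ] ∀ n → N ℕ.≤ n → seq x n ℚ.≤ B
eventually-bounded-above x with cauchy x 1ℚ (ℚ.positive⁻¹ 1ℚ)
... | N , p = 1ℚ ℚ.+ ∣ seq x N ∣ , B>0 , N , λ n ≤n → begin
    seq x n
      ≡⟨ solve 2 (λ a b → a := (a :- b) :+ b) refl (seq x n) (seq x N) ⟩
    (seq x n ℚ.- seq x N) ℚ.+ seq x N
      ≤⟨ ℚ.+-mono-≤ (p≤∣p∣ (seq x n ℚ.- seq x N)) (p≤∣p∣ (seq x N)) ⟩
    ∣ seq x n ℚ.- seq x N ∣ ℚ.+ ∣ seq x N ∣
      ≤⟨ ℚ.+-monoˡ-≤ ∣ seq x N ∣ (ℚ.<⇒≤ (p n N ≤n ℕ.≤-refl)) ⟩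
    1ℚ ℚ.+ ∣ seq x N ∣ ∎
  where
  open ℚ.≤-Reasoning
  open +-*-Solver
  B>0 : Positive (1ℚ ℚ.+ ∣ seq x N ∣)
  B>0 = ℚ.pos+nonNeg⇒pos 1ℚ ∣ seq x N ∣ {{ℚ.nonNegative (ℚ.0≤∣p∣ (seq x N))}}
  p≤∣p∣ : ∀ q → q ℚ.≤ ∣ q ∣
  p≤∣p∣ q with ℚ.≤-total 0ℚ q
  ... | inj₁ 0≤q = ℚ.≤-reflexive (sym (ℚ.0≤p⇒∣p∣≡p 0≤q))
  ... | inj₂ q≤0 = ℚ.≤-trans q≤0 (ℚ.0≤∣p∣ q)

-- Take the minimum of ε / C and 1; the cap at 1 lets `*-nonNeg` bound the δ inside u + v + δ.
small-factor : ∀ C ε → Positive C → 0ℚ ℚ.< ε →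
  ∃[ δ ] 0ℚ ℚ.< δ × δ ℚ.≤ 1ℚ × δ ℚ.* C ℚ.≤ ε
small-factor C ε C>0 ε>0 = δ , δ>0 , ℚ.p⊓q≤q η 1ℚ , (begin
    δ ℚ.* C             ≤⟨ ℚ.*-monoʳ-≤-nonNeg C {{ℚ.pos⇒nonNeg C {{C>0}}}} (ℚ.p⊓q≤p η 1ℚ) ⟩
    η ℚ.* C             ≡⟨ ℚ.*-assoc ε (1/ C) C ⟩
    ε ℚ.* (1/ C ℚ.* C)  ≡⟨ cong (ε ℚ.*_) (ℚ.*-inverseˡ C) ⟩
    ε ℚ.* 1ℚ            ≡⟨ ℚ.*-identityʳ ε ⟩
    ε                   ∎)
  where
  open ℚ.≤-Reasoning
  instance
    C≢0 : ℚ.NonZero C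
    C≢0 = ℚ.pos⇒nonZero C {{C>0}}
  η δ : ℚ
  η = ε ℚ.* 1/ C
  δ = η ℚ.⊓ 1ℚ
  η>0 : 0ℚ ℚ.< η
  η>0 = ℚ.positive⁻¹ η {{ℚ.pos*pos⇒pos ε {{ℚ.positive ε>0}} (1/ C) {{ℚ.1/pos⇒pos C {{C>0}}}}}}
  δ>0 : 0ℚ ℚ.< δ
  δ>0 with ℚ.⊓-sel η 1ℚ
  ... | inj₁ δ≡η = subst (0ℚ ℚ.<_) (sym δ≡η) η>0
  ... | inj₂ δ≡1 = subst (0ℚ ℚ.<_) (sym δ≡1) (ℚ.positive⁻¹ 1ℚ)

ℚ-*-nonNeg : ∀ {p q} → 0ℚ ℚ.≤ p → 0ℚ ℚ.≤ q → 0ℚ ℚ.≤ p ℚ.* q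
ℚ-*-nonNeg {p} {q} 0≤p 0≤q = ℚ.nonNegative⁻¹ (p ℚ.* q)
  {{ℚ.nonNeg*nonNeg⇒nonNeg p {{ℚ.nonNegative 0≤p}} q {{ℚ.nonNegative 0≤q}}}}

-- From u, v ≥ -δ one gets 0 ≤ (u + δ)(v + δ) = uv + δ(u + v + δ).
*-nonNeg : ∀ {x y} → 0ℝ ≲ x → 0ℝ ≲ y → 0ℝ ≲ x * y
*-nonNeg {x} {y} (wrap 0≤x) (wrap 0≤y) = wrap λ ε ε>0 →
  let A , A>0 , K , bx = eventually-bounded-above x
      B , B>0 , L , by = eventually-bounded-above y
      C>0 = ℚ.pos+pos⇒pos (A ℚ.+ B) {{ℚ.pos+pos⇒pos A {{A>0}} B {{B>0}}}} 1ℚ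
      δ , δ>0 , δ≤1 , δC≤ε = small-factor ((A ℚ.+ B) ℚ.+ 1ℚ) ε C>0 ε>0
      M , p = 0≤x δ δ>0
      N , q = 0≤y δ δ>0
  in (K ℕ.⊔ L) ℕ.⊔ (M ℕ.⊔ N) , λ n ≤n →
    let u = seq x n
        v = seq y n
        ≤KL = ℕ.m⊔n≤o⇒m≤o (K ℕ.⊔ L) (M ℕ.⊔ N) ≤n
        ≤MN = ℕ.m⊔n≤o⇒n≤o (K ℕ.⊔ L) (M ℕ.⊔ N) ≤n
    in begin
    0ℚ
      ≤⟨ ℚ-*-nonNeg (p n (ℕ.m⊔n≤o⇒m≤o M N ≤MN)) (q n (ℕ.m⊔n≤o⇒n≤o M N ≤MN)) ⟩
    (u ℚ.+ δ) ℚ.* (v ℚ.+ δ)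
      ≡⟨ solve 3 (λ u v δ → (u :+ δ) :* (v :+ δ) := u :* v :+ δ :* ((u :+ v) :+ δ)) refl u v δ ⟩
    u ℚ.* v ℚ.+ δ ℚ.* ((u ℚ.+ v) ℚ.+ δ)
      ≤⟨ ℚ.+-monoʳ-≤ (u ℚ.* v) (ℚ.*-monoˡ-≤-nonNeg δ {{ℚ.nonNegative (ℚ.<⇒≤ δ>0)}}
           (ℚ.+-mono-≤ (ℚ.+-mono-≤ (bx n (ℕ.m⊔n≤o⇒m≤o K L ≤KL)) (by n (ℕ.m⊔n≤o⇒n≤o K L ≤KL))) δ≤1)) ⟩
    u ℚ.* v ℚ.+ δ ℚ.* ((A ℚ.+ B) ℚ.+ 1ℚ)
      ≤⟨ ℚ.+-monoʳ-≤ (u ℚ.* v) δC≤ε ⟩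
    u ℚ.* v ℚ.+ ε ∎
  where
  open ℚ.≤-Reasoning
  open +-*-Solver

-- Turns an inequality into a polynomial identity, which the ring solver can check on each term of
-- the Cauchy sequences.
≲-by-difference : ∀ {x y d} → 0ℝ ≲ d → (∀ n → seq y n ≡ seq x n ℚ.+ seq d n) → x ≲ y
≲-by-difference {x} 0≲d y≈x+d =
  ≲-trans (≈⇒≲ λ n → sym (ℚ.+-identityʳ (seq x n)))
    (≲-trans (+-mono-≲ (≲-refl {x}) 0≲d) (≈⇒≲ λ n → sym (y≈x+d n)))

difference-nonNeg : ∀ {x y} → x ≲ y → 0ℝ ≲ y + - x
difference-nonNeg {x} x≲y =
  ≲-trans (≈⇒≲ λ n → sym (ℚ.+-inverseʳ (seq x n))) (+-mono-≲ x≲y (≲-refl { - x }))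

*-mono-≲ : ∀ {x y u v} → 0ℝ ≲ x → 0ℝ ≲ u → x ≲ y → u ≲ v → x * u ≲ y * v
*-mono-≲ {x} {y} {u} {v} 0≲x 0≲u x≲y u≲v = ≲-by-difference
  (+-nonNeg (*-nonNeg (difference-nonNeg x≲y) 0≲u)
            (*-nonNeg (≲-trans 0≲x x≲y) (difference-nonNeg u≲v)))
  λ n → solve 4 (λ x y u v → y :* v := x :* u :+ ((y :- x) :* u :+ y :* (v :- u))) refl
    (seq x n) (seq y n) (seq u n) (seq v n)
  where open +-*-Solver

1-nonNeg : 0ℝ ≲ 1ℝ
1-nonNeg = pointwise-≲ λ _ → ℚ.nonNegative⁻¹ 1ℚ

^-nonNeg : ∀ {x} l → 0ℝ ≲ x → 0ℝ ≲ x ^ l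
^-nonNeg zero    0≲x = 1-nonNeg
^-nonNeg (suc l) 0≲x = *-nonNeg 0≲x (^-nonNeg l 0≲x)

^-mono-≲ : ∀ {x y} l → 0ℝ ≲ x → x ≲ y → x ^ l ≲ y ^ l
^-mono-≲ zero    0≲x x≲y = ≲-refl
^-mono-≲ (suc l) 0≲x x≲y = *-mono-≲ 0≲x (^-nonNeg l 0≲x) x≲y (^-mono-≲ l 0≲x x≲y)

^-distrib-* : ∀ x y l n → seq ((x * y) ^ l) n ≡ seq (x ^ l * y ^ l) n
^-distrib-* x y zero    n = refl
^-distrib-* x y (suc l) n = trans
  (cong (seq x n ℚ.* seq y n ℚ.*_) (^-distrib-* x y l n))
  (solve 4 (λ x y u v → x :* y :* (u :* v) := (x :* u) :* (y :* v)) refl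
    (seq x n) (seq y n) (seq (x ^ l) n) (seq (y ^ l) n))
  where open +-*-Solver

-- Lifts an exchange inequality between linear weights to their l-th powers, since `x ^ l * y ^ l`
-- is the l-th power of `x * y`.
^-mono-product : ∀ {x y z w} l → 0ℝ ≲ x → 0ℝ ≲ y → x * y ≲ z * w → x ^ l * y ^ l ≲ z ^ l * w ^ l
^-mono-product {x} {y} {z} {w} l 0≲x 0≲y xy≲zw =
  ≲-trans (≈⇒≲ λ n → sym (^-distrib-* x y l n))
    (≲-trans (^-mono-≲ l (*-nonNeg 0≲x 0≲y) xy≲zw) (≈⇒≲ (^-distrib-* z w l)))

-- Brings together the two A-weights and the two B-weights of a gaining and a losing pair of steps.
*-shuffle : ∀ a b c d n → seq ((a * b) * (c * d)) n ≡ seq ((a * d) * (b * c)) n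
*-shuffle a b c d n = solve 4 (λ a b c d → (a :* b) :* (c :* d) := (a :* d) :* (b :* c)) refl
  (seq a n) (seq b n) (seq c n) (seq d n)
  where open +-*-Solver

-- The four choices of last steps, in the order AA, BB, BA, AB. In the BA term the weights stand
-- next to `c`, ready to become the head of the list.
expand-product : ∀ a₁ b₁ a₂ b₂ x₀ x₁ y₁ y₂ c n →
  seq (((a₁ * x₁ + b₁ * x₀) * (a₂ * y₂ + b₂ * y₁)) * c) n ≡
  seq (((a₁ * a₂) * ((x₁ * y₂) * c) + (b₁ * b₂) * ((x₀ * y₁) * c)) +
       ((x₀ * y₂) * ((b₁ * a₂) * c) + (a₁ * b₂) * ((x₁ * y₁) * c))) n
expand-product a₁ b₁ a₂ b₂ x₀ x₁ y₁ y₂ c n = solve 9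
  (λ a₁ b₁ a₂ b₂ x₀ x₁ y₁ y₂ c →
    ((a₁ :* x₁ :+ b₁ :* x₀) :* (a₂ :* y₂ :+ b₂ :* y₁)) :* c :=
    ((a₁ :* a₂) :* ((x₁ :* y₂) :* c) :+ (b₁ :* b₂) :* ((x₀ :* y₁) :* c)) :+
    ((x₀ :* y₂) :* ((b₁ :* a₂) :* c) :+ (a₁ :* b₂) :* ((x₁ :* y₁) :* c)))
  refl (seq a₁ n) (seq b₁ n) (seq a₂ n) (seq b₂ n)
       (seq x₀ n) (seq x₁ n) (seq y₁ n) (seq y₂ n) (seq c n)
  where open +-*-Solver

-- Log-concavity from exchange inequalities for the weights

module Triangle
  (A B t : ℕ → ℕ → ℝ)
  (A-nonNeg : ∀ {n k} → 1 ℕ.≤ n → 1 ℕ.≤ k → 0ℝ ≲ A n k)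
  (B-nonNeg : ∀ {n k} → 1 ℕ.≤ k → k ℕ.≤ n → 0ℝ ≲ B n k)
  (A-exchange : ∀ {m n j k} → 1 ℕ.≤ m → 1 ℕ.≤ j → m ℕ.≤ n → j ℕ.≤ k →
    A m j * A n (suc k) ≲ A m (suc j) * A n k)
  -- The last condition reads n - k ≥ m - j: the distance to the diagonal has not dropped from
  -- `(m , j)` to `(n , k)`.
  (B-exchange : ∀ {m n j k} → 1 ℕ.≤ k → suc j ℕ.≤ m → m ℕ.≤ n → m ℕ.+ k ℕ.≤ n ℕ.+ j →
    B m (suc j) * B n k ≲ B m j * B n (suc k))
  (AB-exchange : ∀ {n k} → 1 ℕ.≤ k → 2 ℕ.+ k ℕ.≤ n →
    A n k * B n (2 ℕ.+ k) ≲ A n (suc k) * B n (suc k))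
  (t-nonNeg : ∀ n k → 0ℝ ≲ t n k)
  (t-column-0 : ∀ n → t n 0 ≡ 0ℝ)
  (t-above-diagonal : ∀ {n k} → n ℕ.< k → t n k ≡ 0ℝ)
  (t-recurrence : ∀ {n k} → suc k ℕ.≤ 2 ℕ.+ n →
    t (2 ℕ.+ n) (suc k) ≡
      A (2 ℕ.+ n) (suc k) * t (suc n) (suc k) + B (2 ℕ.+ n) (suc k) * t (suc n) k)
  where

  -- c holds the weight of a losing pair of steps before and after the exchange.
  -- absorb matches it with the gaining pair of steps of any row m that a pair of
  -- paths now at columns i and j of row n can have passed.
  record Pending (n i j : ℕ) (c : ℝ × ℝ) : Set where
    field
      old-nonNeg : 0ℝ ≲ proj₁ c
      new-nonNeg : 0ℝ ≲ proj₂ c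
      absorb : ∀ {m p q} → 1 ℕ.≤ p → suc q ℕ.≤ m → m ℕ.≤ n → p ℕ.≤ i →
        m ℕ.+ j ℕ.≤ n ℕ.+ suc q →
        (A m p * B m (suc q)) * proj₁ c ≲ (A m (suc p) * B m q) * proj₂ c

  open Pending

  -- Back from row `n` to row `n′`, the lower column does not rise and the upper one falls by at
  -- most one per row. So every gain that can be met from the new position could be met from the old
  -- one.
  weaken : ∀ {n i j n′ i′ j′} → n′ ℕ.≤ n → i′ ℕ.≤ i → n′ ℕ.+ j ℕ.≤ n ℕ.+ j′ →
    ∀ {c} → Pending n i j c → Pending n′ i′ j′ c
  weaken {n} {i} {j} {n′} {i′} {j′} n′≤n i′≤i n′+j≤n+j′ pend = record
    { old-nonNeg = old-nonNeg pend
    ; new-nonNeg = new-nonNeg pend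
    ; absorb = λ {m} {p} {q} 1≤p q<m m≤n′ p≤i′ m+j′≤n′+q →
        absorb pend 1≤p q<m (ℕ.≤-trans m≤n′ n′≤n) (ℕ.≤-trans p≤i′ i′≤i)
          (ℕ.+-cancelʳ-≤ (n′ ℕ.+ j′) (m ℕ.+ j) (n ℕ.+ suc q) (begin
            (m ℕ.+ j) ℕ.+ (n′ ℕ.+ j′)       ≡⟨ interchange m j n′ j′ ⟩
            (m ℕ.+ j′) ℕ.+ (n′ ℕ.+ j)       ≤⟨ ℕ.+-mono-≤ m+j′≤n′+q n′+j≤n+j′ ⟩
            (n′ ℕ.+ suc q) ℕ.+ (n ℕ.+ j′)   ≡⟨ ℕ.+-comm (n′ ℕ.+ suc q) (n ℕ.+ j′) ⟩
            (n ℕ.+ j′) ℕ.+ (n′ ℕ.+ suc q)   ≡⟨ interchange n j′ n′ (suc q) ⟩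
            (n ℕ.+ suc q) ℕ.+ (n′ ℕ.+ j′)   ∎))
    }
    where
    open ℕ.≤-Reasoning
    interchange : ∀ a b c d → (a ℕ.+ b) ℕ.+ (c ℕ.+ d) ≡ (a ℕ.+ d) ℕ.+ (c ℕ.+ b)
    interchange = solve 4 (λ a b c d → (a :+ b) :+ (c :+ d) := (a :+ d) :+ (c :+ b)) refl
      where open ℕ-Solver

  -- The loss in row `suc n`: the lower path rises to `suc i`, the upper one stays at `2 + j`. In
  -- `absorb` the matching is crosswise: the lower path's A-gain pays for the upper path's A-loss,
  -- and the upper path's B-gain for the lower path's B-loss.
  push : ∀ {n i j} → i ℕ.≤ j → 2 ℕ.+ j ℕ.≤ suc n →
    Pending n i (2 ℕ.+ j)
      (B (suc n) (suc i) * A (suc n) (2 ℕ.+ j) , B (suc n) (2 ℕ.+ i) * A (suc n) (suc j))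
  push {n} {i} {j} i≤j j<n = record
    { old-nonNeg = *-nonNeg 0≲B 0≲A
    ; new-nonNeg = *-nonNeg (B-nonNeg (s≤s z≤n) i<n) (A-nonNeg (s≤s z≤n) (s≤s z≤n))
    ; absorb = λ {m} {p} {q} 1≤p q<m m≤n p≤i m+j≤n+q →
        let 1≤m = ℕ.≤-trans (s≤s z≤n) q<m
            m+i≤n+q = ℕ.≤-trans (ℕ.+-monoʳ-≤ m (s≤s (ℕ.m≤n⇒m≤1+n i≤j)))
                        (ℕ.≤-trans m+j≤n+q (ℕ.≤-reflexive (ℕ.+-suc n q)))
        in ≲-trans (≈⇒≲ (*-shuffle (A m p) (B m (suc q)) (B (suc n) (suc i)) (A (suc n) (2 ℕ.+ j))))
          (≲-trans
            (*-mono-≲ (*-nonNeg (A-nonNeg 1≤m 1≤p) 0≲A) (*-nonNeg (B-nonNeg (s≤s z≤n) q<m) 0≲B)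
              (A-exchange 1≤m 1≤p (ℕ.m≤n⇒m≤1+n m≤n) (ℕ.m≤n⇒m≤1+n (ℕ.≤-trans p≤i i≤j)))
              (B-exchange (s≤s z≤n) q<m (ℕ.m≤n⇒m≤1+n m≤n) m+i≤n+q))
            (≈⇒≲ λ x → sym (*-shuffle (A m (suc p)) (B m q) (B (suc n) (2 ℕ.+ i)) (A (suc n) (suc j)) x)))
    }
    where
    i<n : 2 ℕ.+ i ℕ.≤ suc n
    i<n = ℕ.≤-trans (s≤s (s≤s i≤j)) j<n
    0≲A : 0ℝ ≲ A (suc n) (2 ℕ.+ j)
    0≲A = A-nonNeg (s≤s z≤n) (s≤s z≤n)
    0≲B : 0ℝ ≲ B (suc n) (suc i)
    0≲B = B-nonNeg (s≤s z≤n) (ℕ.≤-trans (ℕ.n≤1+n _) i<n)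

  -- The induction on the row.

  old new : List (ℝ × ℝ) → ℝ
  old []            = 1ℝ
  old ((c , _) ∷ L) = c * old L
  new []            = 1ℝ
  new ((_ , c) ∷ L) = c * new L

  old-product-nonNeg : ∀ {n i j L} → All (Pending n i j) L → 0ℝ ≲ old L
  old-product-nonNeg []             = 1-nonNeg
  old-product-nonNeg (pend ∷ pends) = *-nonNeg (old-nonNeg pend) (old-product-nonNeg pends)

  new-product-nonNeg : ∀ {n i j L} → All (Pending n i j) L → 0ℝ ≲ new L
  new-product-nonNeg []             = 1-nonNeg
  new-product-nonNeg (pend ∷ pends) = *-nonNeg (new-nonNeg pend) (new-product-nonNeg pends)

  Exchange : ℕ → ℕ → ℕ → List (ℝ × ℝ) → Set
  Exchange n i j L =
    (t n i * t n (2 ℕ.+ j)) * old L ≲ (t n (suc i) * t n (suc j)) * new L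

  -- Boundary case: the left side vanishes and the right side is a product of non-negative factors.
  exchange-0 : ∀ {n i j L} → All (Pending n i (2 ℕ.+ j)) L →
    t n i * t n (2 ℕ.+ j) ≲ 0ℝ → Exchange n i j L
  exchange-0 {n} {i} {j} {L} pends xy≲0 =
    ≲-trans (*-mono-≲ (*-nonNeg (t-nonNeg n i) (t-nonNeg n (2 ℕ.+ j))) (old-product-nonNeg pends) xy≲0 ≲-refl)
      (≲-trans (≈⇒≲ λ n → ℚ.*-zeroˡ (seq (old L) n))
        (*-nonNeg (*-nonNeg (t-nonNeg n (suc i)) (t-nonNeg n (suc j))) (new-product-nonNeg pends)))

  -- The last steps of the two paths give four terms on each side.  AA and BB keep
  -- the distance; BA is a loss and enters L; AB is a gain and uses up an entry of
  -- L, or, when L is empty, is the place where the paths are exchanged.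
  step : ∀ {m i j} L → suc j ≡ length L ℕ.+ suc i → 3 ℕ.+ j ℕ.≤ 2 ℕ.+ m →
    All (Pending (2 ℕ.+ m) (suc i) (3 ℕ.+ j)) L →
    (∀ {i j} L → j ≡ length L ℕ.+ i → All (Pending (suc m) i (2 ℕ.+ j)) L →
      Exchange (suc m) i j L) →
    Exchange (2 ℕ.+ m) (suc i) (suc j) L
  step {m} {i} {j} L len j<n pends ih =
    subst₂ _≲_
      (sym (cong₂ (λ x y → (x * y) * old L) (t-recurrence i<n) (t-recurrence j<n)))
      (sym (cong₂ (λ x y → (x * y) * new L) (t-recurrence 1+i<n) (t-recurrence 1+j<n)))
      (≲-trans
        (≈⇒≲ (expand-product (A n (suc i)) (B n (suc i)) (A n (3 ℕ.+ j)) (B n (3 ℕ.+ j))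
                (x i) (x (suc i)) (x (2 ℕ.+ j)) (x (3 ℕ.+ j)) (old L)))
        (≲-trans (+-mono-≲ (+-mono-≲ AA BB) (+-mono-≲ BA (AB L len pends)))
          (≈⇒≲ λ k → sym (expand-product (A n (2 ℕ.+ i)) (B n (2 ℕ.+ i)) (A n (2 ℕ.+ j)) (B n (2 ℕ.+ j))
                (x (suc i)) (x (2 ℕ.+ i)) (x (suc j)) (x (2 ℕ.+ j)) (new L) k))))
    where
    n = 2 ℕ.+ m
    x = t (suc m)

    i≤j : i ℕ.≤ j
    i≤j = ℕ.≤-pred (ℕ.≤-trans (ℕ.m≤n+m (suc i) (length L)) (ℕ.≤-reflexive (sym len)))
    1+j<n : 2 ℕ.+ j ℕ.≤ n
    1+j<n = ℕ.≤-trans (ℕ.n≤1+n _) j<n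
    1+i<n : 2 ℕ.+ i ℕ.≤ n
    1+i<n = ℕ.≤-trans (s≤s (s≤s i≤j)) 1+j<n
    i<n : suc i ℕ.≤ n
    i<n = ℕ.≤-trans (ℕ.n≤1+n _) 1+i<n

    A≥0 : ∀ k → 0ℝ ≲ A n (suc k)
    A≥0 k = A-nonNeg (s≤s z≤n) (s≤s z≤n)
    xx≥0 : ∀ p q {c} → 0ℝ ≲ c → 0ℝ ≲ (x p * x q) * c
    xx≥0 p q 0≲c = *-nonNeg (*-nonNeg (t-nonNeg (suc m) p) (t-nonNeg (suc m) q)) 0≲c

    -- One row back, the upper path is at `2 + j` if its last step rose (`shrink`) and still at
    -- `3 + j` if not (`keep`).
    shrink : ∀ {i′} → i′ ℕ.≤ suc i → ∀ {c} → Pending n (suc i) (3 ℕ.+ j) c → Pending (suc m) i′ (2 ℕ.+ j) c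
    shrink i′≤i = weaken (ℕ.n≤1+n _) i′≤i (ℕ.≤-reflexive (ℕ.+-suc (suc m) (2 ℕ.+ j)))
    keep : ∀ {i′} → i′ ℕ.≤ suc i → ∀ {c} → Pending n (suc i) (3 ℕ.+ j) c → Pending (suc m) i′ (3 ℕ.+ j) c
    keep i′≤i = weaken (ℕ.n≤1+n _) i′≤i (ℕ.n≤1+n _)

    AA : (A n (suc i) * A n (3 ℕ.+ j)) * ((x (suc i) * x (3 ℕ.+ j)) * old L) ≲
         (A n (2 ℕ.+ i) * A n (2 ℕ.+ j)) * ((x (2 ℕ.+ i) * x (2 ℕ.+ j)) * new L)
    AA = *-mono-≲ (*-nonNeg (A≥0 i) (A≥0 (2 ℕ.+ j))) (xx≥0 (suc i) (3 ℕ.+ j) (old-product-nonNeg pends))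
      (A-exchange (s≤s z≤n) (s≤s z≤n) ℕ.≤-refl (s≤s (ℕ.m≤n⇒m≤1+n i≤j)))
      (ih L len (All.map (keep ℕ.≤-refl) pends))

    BB : (B n (suc i) * B n (3 ℕ.+ j)) * ((x i * x (2 ℕ.+ j)) * old L) ≲
         (B n (2 ℕ.+ i) * B n (2 ℕ.+ j)) * ((x (suc i) * x (suc j)) * new L)
    BB = *-mono-≲ (*-nonNeg (B-nonNeg (s≤s z≤n) i<n) (B-nonNeg (s≤s z≤n) j<n)) (xx≥0 i (2 ℕ.+ j) (old-product-nonNeg pends))
      (≲-trans (≈⇒≲ λ k → ℚ.*-comm (seq (B n (suc i)) k) (seq (B n (3 ℕ.+ j)) k))
        -- `B-exchange` moves its first factor down a column and its second up, so the upper path's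
        -- weight must come first.
        (≲-trans (B-exchange (s≤s z≤n) j<n ℕ.≤-refl (ℕ.+-monoʳ-≤ n (s≤s (ℕ.m≤n⇒m≤1+n i≤j))))
          (≈⇒≲ λ k → ℚ.*-comm (seq (B n (2 ℕ.+ j)) k) (seq (B n (2 ℕ.+ i)) k))))
      (ih L (ℕ.suc-injective (trans len (ℕ.+-suc (length L) i))) (All.map (shrink (ℕ.n≤1+n i)) pends))

    BA : (x i * x (3 ℕ.+ j)) * ((B n (suc i) * A n (3 ℕ.+ j)) * old L) ≲
         (x (suc i) * x (2 ℕ.+ j)) * ((B n (2 ℕ.+ i) * A n (2 ℕ.+ j)) * new L)
    BA = ih (_ ∷ L) (trans len (ℕ.+-suc (length L) i))
      (push (ℕ.m≤n⇒m≤1+n i≤j) j<n ∷ All.map (keep (ℕ.n≤1+n i)) pends)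

    AB : ∀ L → suc j ≡ length L ℕ.+ suc i → All (Pending n (suc i) (3 ℕ.+ j)) L →
         (A n (suc i) * B n (3 ℕ.+ j)) * ((x (suc i) * x (2 ℕ.+ j)) * old L) ≲
         (A n (2 ℕ.+ i) * B n (2 ℕ.+ j)) * ((x (2 ℕ.+ i) * x (suc j)) * new L)
    -- With no pending loss `j` equals `i`: the paths came from the adjacent columns `suc i` and
    -- `2 + i`, and exchanging them only swaps two factors.
    AB [] refl [] = *-mono-≲ (*-nonNeg (A≥0 i) (B-nonNeg (s≤s z≤n) j<n)) (xx≥0 (suc i) (2 ℕ.+ j) 1-nonNeg)
      (AB-exchange (s≤s z≤n) j<n)
      (≈⇒≲ λ k → cong (ℚ._* 1ℚ) (ℚ.*-comm (seq (x (suc i)) k) (seq (x (2 ℕ.+ j)) k)))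
    AB ((c , c′) ∷ L) len (pend ∷ pends) =
      ≲-trans (≈⇒≲ (regroup (A n (suc i) * B n (3 ℕ.+ j)) (x (suc i) * x (2 ℕ.+ j)) c (old L)))
        (≲-trans
          (*-mono-≲
            (*-nonNeg (*-nonNeg (A≥0 i) (B-nonNeg (s≤s z≤n) j<n)) (old-nonNeg pend))
            (xx≥0 (suc i) (2 ℕ.+ j) (old-product-nonNeg pends))
            -- The gain is in row `n` itself, at the current columns, so all bounds hold with
            -- equality. The head of `L` is the loss read most recently, as in matching parentheses.
            (absorb pend (s≤s z≤n) j<n ℕ.≤-refl ℕ.≤-refl ℕ.≤-refl)
            (ih L (ℕ.suc-injective len) (All.map (shrink ℕ.≤-refl) pends)))
          (≈⇒≲ λ k → sym (regroup (A n (2 ℕ.+ i) * B n (2 ℕ.+ j)) (x (2 ℕ.+ i) * x (suc j)) c′ (new L) k)))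
      where
      regroup : ∀ a b c d k → seq (a * (b * (c * d))) k ≡ seq ((a * c) * (b * d)) k
      regroup a b c d k = solve 4 (λ a b c d → a :* (b :* (c :* d)) := (a :* c) :* (b :* d)) refl
        (seq a k) (seq b k) (seq c k) (seq d k)
        where open +-*-Solver

  -- The length condition says that the distance of the columns `i` and `2 + j` is 2 plus the number
  -- of pending losses. It makes `i ≤ j`, and `L = []` gives log-concavity.
  exchange : ∀ n {i j} L → j ≡ length L ℕ.+ i → All (Pending n i (2 ℕ.+ j)) L → Exchange n i j L
  exchange n {i} {j} L len pends with 2 ℕ.+ j ℕ.≤? n
  ... | no j≰n = exchange-0 pends (≈⇒≲ λ k → trans
    (cong (λ y → seq (t n i) k ℚ.* seq y k) (t-above-diagonal (ℕ.≰⇒> j≰n)))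
    (ℚ.*-zeroʳ (seq (t n i) k)))
  exchange n {zero} {j} L len pends | yes j≤n = exchange-0 pends (≈⇒≲ λ k → trans
    (cong (λ y → seq y k ℚ.* seq (t n (2 ℕ.+ j)) k) (t-column-0 n))
    (ℚ.*-zeroˡ (seq (t n (2 ℕ.+ j)) k)))
  exchange n {suc i} {zero} L len pends | yes j≤n =
    contradiction (trans len (ℕ.+-suc (length L) i)) λ ()
  exchange (suc zero) {suc i} {suc j} L len pends | yes (s≤s ())
  exchange (suc (suc m)) {suc i} {suc j} L len pends | yes j≤n =
    step L len j≤n pends (exchange (suc m))

  log-concave : ∀ n i → t n i * t n (2 ℕ.+ i) ≲ t n (suc i) * t n (suc i)
  log-concave n i = ≲-trans (≈⇒≲ λ k → sym (ℚ.*-identityʳ _))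
    (≲-trans (exchange n [] refl []) (≈⇒≲ λ k → ℚ.*-identityʳ _))

-- The weights of the recurrence

ι : ℕ → ℝ
ι n = fromℤ (+ n)

ι-nonNeg : ∀ n → 0ℝ ≲ ι n
ι-nonNeg n = pointwise-≲ λ _ → ℚ.nonNegative⁻¹ (+ n ℚ./ 1) {{ℚ.normalize-nonNeg n 1}}

-- Division by 1 in ℚ normalises by a gcd; in unnormalised fractions the denominators are literally
-- 1.
ι-+ : ∀ m n → + (m ℕ.+ n) ℚ./ 1 ≡ (+ m ℚ./ 1) ℚ.+ (+ n ℚ./ 1)
ι-+ m n = ℚ.toℚᵘ-injective (begin
  ℚ.toℚᵘ (+ (m ℕ.+ n) ℚ./ 1)
    ≈⟨ ℚ.toℚᵘ-fromℚᵘ (ℚᵘ.mkℚᵘ (+ (m ℕ.+ n)) 0) ⟩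
  ℚᵘ.mkℚᵘ (+ (m ℕ.+ n)) 0
    ≈⟨ ℚᵘ.*≡* (cong (ℤ._* 1ℤ) (sym (cong₂ ℤ._+_ (ℤ.*-identityʳ (+ m)) (ℤ.*-identityʳ (+ n))))) ⟩
  ℚᵘ.mkℚᵘ (+ m) 0 ℚᵘ.+ ℚᵘ.mkℚᵘ (+ n) 0
    ≈⟨ ℚᵘ.+-cong (ℚ.toℚᵘ-fromℚᵘ (ℚᵘ.mkℚᵘ (+ m) 0)) (ℚ.toℚᵘ-fromℚᵘ (ℚᵘ.mkℚᵘ (+ n) 0)) ⟨
  ℚ.toℚᵘ (+ m ℚ./ 1) ℚᵘ.+ ℚ.toℚᵘ (+ n ℚ./ 1)
    ≈⟨ ℚ.toℚᵘ-homo-+ (+ m ℚ./ 1) (+ n ℚ./ 1) ⟨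
  ℚ.toℚᵘ ((+ m ℚ./ 1) ℚ.+ (+ n ℚ./ 1)) ∎)
  where open ℚᵘ.≃-Reasoning

ι-suc : ∀ n → + suc n ℚ./ 1 ≡ 1ℚ ℚ.+ (+ n ℚ./ 1)
ι-suc = ι-+ 1

linear : (α β γ : ℝ) → ℕ → ℕ → ℝ
linear α β γ n k = α * ι n + β * ι k + γ

-- Linear weights that increase with the column.

module Increasing (α β γ : ℝ) (0≲α : 0ℝ ≲ α) (0≲β : 0ℝ ≲ β) (0≲s : 0ℝ ≲ α + β + γ) where

  a : ℕ → ℕ → ℝ
  a = linear α β γ

  nonNeg : ∀ {n k} → 1 ℕ.≤ n → 1 ℕ.≤ k → 0ℝ ≲ a n k
  -- Expansion around the corner `(1 , 1)`, where the weight is α + β + γ.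
  nonNeg {suc e} {suc f} _ _ = ≲-by-difference
    (+-nonNeg 0≲s (+-nonNeg (*-nonNeg 0≲α (ι-nonNeg e)) (*-nonNeg 0≲β (ι-nonNeg f))))
    λ i → identity (seq α i) (seq β i) (seq γ i) (ι-suc e) (ι-suc f)
    where
    identity : ∀ α β γ {n k e f} → n ≡ 1ℚ ℚ.+ e → k ≡ 1ℚ ℚ.+ f →
      α ℚ.* n ℚ.+ β ℚ.* k ℚ.+ γ ≡
      0ℚ ℚ.+ ((α ℚ.+ β ℚ.+ γ) ℚ.+ (α ℚ.* e ℚ.+ β ℚ.* f))
    identity α β γ {e = e} {f} refl refl = solve 5 (λ α β γ e f →
      α :* (con 1ℚ :+ e) :+ β :* (con 1ℚ :+ f) :+ γ :=
      con 0ℚ :+ ((α :+ β :+ γ) :+ (α :* e :+ β :* f))) refl α β γ e f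
      where open +-*-Solver

  mono : ∀ n k → a n k ≲ a n (suc k)
  mono n k = ≲-by-difference 0≲β
    λ i → identity (seq α i) (seq β i) (seq γ i) (+ n ℚ./ 1) (ι-suc k)
    where
    identity : ∀ α β γ n {k k′} → k′ ≡ 1ℚ ℚ.+ k →
      α ℚ.* n ℚ.+ β ℚ.* k′ ℚ.+ γ ≡ (α ℚ.* n ℚ.+ β ℚ.* k ℚ.+ γ) ℚ.+ β
    identity α β γ n {k} refl = solve 5 (λ α β γ n k →
      α :* n :+ β :* (con 1ℚ :+ k) :+ γ := (α :* n :+ β :* k :+ γ) :+ β) refl α β γ n k
      where open +-*-Solver

  -- With X = `a m j` and Y = `a n k`, the difference is (X + β) Y - X (Y + β) = β (Y - X), and Y ≥
  -- X.
  exchange : ∀ {m n j k} → m ℕ.≤ n → j ℕ.≤ k → a m j * a n (suc k) ≲ a m (suc j) * a n k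
  exchange {m} {n} {j} {k} m≤n j≤k = ≲-by-difference
    (*-nonNeg 0≲β (+-nonNeg (*-nonNeg 0≲α (ι-nonNeg e)) (*-nonNeg 0≲β (ι-nonNeg f))))
    λ i → identity (seq α i) (seq β i) (seq γ i) (+ m ℚ./ 1) (+ j ℚ./ 1) (+ e ℚ./ 1) (+ f ℚ./ 1)
      (trans (cong (λ n → + n ℚ./ 1) (sym (ℕ.m+[n∸m]≡n m≤n))) (ι-+ m e))
      (trans (cong (λ n → + n ℚ./ 1) (sym (ℕ.m+[n∸m]≡n j≤k))) (ι-+ j f))
      (ι-suc j) (ι-suc k)
    where
    e = n ℕ.∸ m
    f = k ℕ.∸ j
    identity : ∀ α β γ m j e f {n k j′ k′} →
      n ≡ m ℚ.+ e → k ≡ j ℚ.+ f → j′ ≡ 1ℚ ℚ.+ j → k′ ≡ 1ℚ ℚ.+ k →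
      (α ℚ.* m ℚ.+ β ℚ.* j′ ℚ.+ γ) ℚ.* (α ℚ.* n ℚ.+ β ℚ.* k ℚ.+ γ) ≡
      (α ℚ.* m ℚ.+ β ℚ.* j ℚ.+ γ) ℚ.* (α ℚ.* n ℚ.+ β ℚ.* k′ ℚ.+ γ)
        ℚ.+ β ℚ.* (α ℚ.* e ℚ.+ β ℚ.* f)
    identity α β γ m j e f refl refl refl refl = solve 7 (λ α β γ m j e f →
      (α :* m :+ β :* (con 1ℚ :+ j) :+ γ) :* (α :* (m :+ e) :+ β :* (j :+ f) :+ γ) :=
      (α :* m :+ β :* j :+ γ) :* (α :* (m :+ e) :+ β :* (con 1ℚ :+ (j :+ f)) :+ γ)
        :+ β :* (α :* e :+ β :* f)) refl α β γ m j e f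
      where open +-*-Solver

-- Linear weights that decrease with the column.

module Decreasing (α β γ : ℝ) (0≲α : 0ℝ ≲ α) (-α≲β : - α ≲ β) (β≲0 : β ≲ 0ℝ)
  (0≲s : 0ℝ ≲ α + β + γ) where

  b : ℕ → ℕ → ℝ
  b = linear α β γ

  0≲-β : 0ℝ ≲ - β
  0≲-β = ≲-trans (difference-nonNeg β≲0) (≈⇒≲ λ i → ℚ.+-identityˡ (ℚ.- seq β i))

  0≲α+β : 0ℝ ≲ α + β
  0≲α+β = ≲-trans (difference-nonNeg -α≲β)
    (≈⇒≲ λ i → solve 2 (λ α β → β :- (:- α) := α :+ β) refl (seq α i) (seq β i))
    where open +-*-Solver

  nonNeg : ∀ {n k} → 1 ℕ.≤ k → k ℕ.≤ n → 0ℝ ≲ b n k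
  -- From `(1 , 1)` go along the diagonal to `(k , k)`, each step adding α + β, then down the
  -- column, each step adding α.
  nonNeg {n} {suc f} _ k≤n = ≲-by-difference
    (+-nonNeg 0≲s (+-nonNeg (*-nonNeg 0≲α+β (ι-nonNeg f)) (*-nonNeg 0≲α (ι-nonNeg e))))
    λ i → identity (seq α i) (seq β i) (seq γ i)
      (trans (cong (λ n → + n ℚ./ 1) (sym (ℕ.m+[n∸m]≡n k≤n))) (ι-+ (suc f) e)) (ι-suc f)
    where
    e = n ℕ.∸ suc f
    identity : ∀ α β γ {n k e f} → n ≡ k ℚ.+ e → k ≡ 1ℚ ℚ.+ f →
      α ℚ.* n ℚ.+ β ℚ.* k ℚ.+ γ ≡
      0ℚ ℚ.+ ((α ℚ.+ β ℚ.+ γ) ℚ.+ ((α ℚ.+ β) ℚ.* f ℚ.+ α ℚ.* e))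
    identity α β γ {e = e} {f} refl refl = solve 5 (λ α β γ e f →
      α :* ((con 1ℚ :+ f) :+ e) :+ β :* (con 1ℚ :+ f) :+ γ :=
      con 0ℚ :+ ((α :+ β :+ γ) :+ ((α :+ β) :* f :+ α :* e))) refl α β γ e f
      where open +-*-Solver

  antitone : ∀ n k → b n (suc k) ≲ b n k
  antitone n k = ≲-by-difference 0≲-β
    λ i → identity (seq α i) (seq β i) (seq γ i) (+ n ℚ./ 1) (ι-suc k)
    where
    identity : ∀ α β γ n {k k′} → k′ ≡ 1ℚ ℚ.+ k →
      α ℚ.* n ℚ.+ β ℚ.* k ℚ.+ γ ≡ (α ℚ.* n ℚ.+ β ℚ.* k′ ℚ.+ γ) ℚ.- β
    identity α β γ n {k} refl = solve 5 (λ α β γ n k →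
      α :* n :+ β :* k :+ γ := (α :* n :+ β :* (con 1ℚ :+ k) :+ γ) :- β) refl α β γ n k
      where open +-*-Solver

  -- With X = `b m j` and Y = `b n k`, the difference is (-β) (Y - X). Since k - j = e - f, Y - X is
  -- (α + β) e + (-β) f.
  exchange : ∀ {m n j k} → m ℕ.≤ n → m ℕ.+ k ℕ.≤ n ℕ.+ j → b m (suc j) * b n k ≲ b m j * b n (suc k)
  exchange {m} {n} {j} {k} m≤n m+k≤n+j = ≲-by-difference
    (*-nonNeg 0≲-β (+-nonNeg (*-nonNeg 0≲α+β (ι-nonNeg e)) (*-nonNeg 0≲-β (ι-nonNeg f))))
    λ i → identity (seq α i) (seq β i) (seq γ i) (+ m ℚ./ 1) (+ k ℚ./ 1) (+ e ℚ./ 1) (+ f ℚ./ 1)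
      (trans (cong (λ n → + n ℚ./ 1) (sym (ℕ.m+[n∸m]≡n m≤n))) (ι-+ m e)) j≡k+f-e
      (ι-suc j) (ι-suc k)
    where
    e = n ℕ.∸ m
    f = (n ℕ.+ j) ℕ.∸ (m ℕ.+ k)
    k+f≡j+e : k ℕ.+ f ≡ j ℕ.+ e
    k+f≡j+e = ℕ.+-cancelˡ-≡ m (k ℕ.+ f) (j ℕ.+ e) (begin
      m ℕ.+ (k ℕ.+ f)   ≡⟨ ℕ.+-assoc m k f ⟨
      (m ℕ.+ k) ℕ.+ f   ≡⟨ ℕ.m+[n∸m]≡n m+k≤n+j ⟩
      n ℕ.+ j           ≡⟨ cong (ℕ._+ j) (ℕ.m+[n∸m]≡n m≤n) ⟨
      (m ℕ.+ e) ℕ.+ j   ≡⟨ ℕ.+-assoc m e j ⟩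
      m ℕ.+ (e ℕ.+ j)   ≡⟨ cong (m ℕ.+_) (ℕ.+-comm e j) ⟩
      m ℕ.+ (j ℕ.+ e)   ∎)
      where open ≡-Reasoning
    j≡k+f-e : + j ℚ./ 1 ≡ ((+ k ℚ./ 1) ℚ.+ (+ f ℚ./ 1)) ℚ.- (+ e ℚ./ 1)
    j≡k+f-e = trans
      (solve 2 (λ j e → j := (j :+ e) :- e) refl (+ j ℚ./ 1) (+ e ℚ./ 1))
      (cong (ℚ._- (+ e ℚ./ 1))
        (trans (sym (ι-+ j e)) (trans (cong (λ n → + n ℚ./ 1) (sym k+f≡j+e)) (ι-+ k f))))
      where open +-*-Solver
    identity : ∀ α β γ m k e f {n j j′ k′} →
      n ≡ m ℚ.+ e → j ≡ (k ℚ.+ f) ℚ.- e → j′ ≡ 1ℚ ℚ.+ j → k′ ≡ 1ℚ ℚ.+ k →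
      (α ℚ.* m ℚ.+ β ℚ.* j ℚ.+ γ) ℚ.* (α ℚ.* n ℚ.+ β ℚ.* k′ ℚ.+ γ) ≡
      (α ℚ.* m ℚ.+ β ℚ.* j′ ℚ.+ γ) ℚ.* (α ℚ.* n ℚ.+ β ℚ.* k ℚ.+ γ)
        ℚ.+ (ℚ.- β) ℚ.* ((α ℚ.+ β) ℚ.* e ℚ.+ (ℚ.- β) ℚ.* f)
    identity α β γ m k e f refl refl refl refl = solve 7 (λ α β γ m k e f →
      (α :* m :+ β :* ((k :+ f) :- e) :+ γ) :* (α :* (m :+ e) :+ β :* (con 1ℚ :+ k) :+ γ) :=
      (α :* m :+ β :* (con 1ℚ :+ ((k :+ f) :- e)) :+ γ) :* (α :* (m :+ e) :+ β :* k :+ γ)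
        :+ (:- β) :* ((α :+ β) :* e :+ (:- β) :* f)) refl α β γ m k e f
      where open +-*-Solver

-- The triangle T

if-yes : ∀ {P : Set} (P? : Dec P) {x y : ℝ} → P → (if ⌊ P? ⌋ then x else y) ≡ x
if-yes (yes _) p = refl
if-yes (no ¬p) p = contradiction p ¬p

if-no : ∀ {P : Set} (P? : Dec P) {x y : ℝ} → ¬ P → (if ⌊ P? ⌋ then x else y) ≡ y
if-no (yes p) ¬p = contradiction p ¬p
if-no (no _)  ¬p = refl

theorem1p4 : (l : ℕ) → 1 ℕ.≤ l →
    (α β γ α′ β′ γ′ : ℝ) →
    0ℝ ≤ α → 0ℝ ≤ α′ → 0ℝ ≤ β →
    - α′ ≤ β′ → β′ ≤ 0ℝ →
    0ℝ ≤ α + β + γ → 0ℝ ≤ α′ + β′ + γ′ →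
    (n : ℕ) → 1 ℕ.≤ n →
    LogConcave (T l α β γ α′ β′ γ′ n)
theorem1p4 l _ α β γ α′ β′ γ′ 0≤α 0≤α′ 0≤β -α′≤β′ β′≤0 0≤s 0≤s′ n _ = λ where
    -- The index k + 1 computes to `suc i + 1`, not to `2 + i`, and the square carries a factor 1.
    (+ suc i)  → unwrap (subst (λ k → U n (+ i) * U n (+ k) ≲ U n (+ suc i) ^ 2)
      (ℕ.+-comm 1 (suc i)) (≲-trans (log-concave n i) (≈⇒≲ λ m →
        cong (seq (t n (suc i)) m ℚ.*_) (sym (ℚ.*-identityʳ (seq (t n (suc i)) m))))))
    (+ 0)      → unwrap (outside (+ 0) (λ { (ℤ.+≤+ ()) }) λ ())
    (-[1+ i ]) → unwrap (outside -[1+ i ] (λ ()) λ ())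
  where
  module a = Increasing α β γ (wrap 0≤α) (wrap 0≤β) (wrap 0≤s)
  module b = Decreasing α′ β′ γ′ (wrap 0≤α′) (wrap -α′≤β′) (wrap β′≤0) (wrap 0≤s′)

  U : ℕ → ℤ → ℝ
  U = T l α β γ α′ β′ γ′

  A B t : ℕ → ℕ → ℝ
  A n k = a.a n k ^ l
  B n k = b.b n k ^ l
  t n k = U n (+ k)

  A-nonNeg : ∀ {n k} → 1 ℕ.≤ n → 1 ℕ.≤ k → 0ℝ ≲ A n k
  A-nonNeg 1≤n 1≤k = ^-nonNeg l (a.nonNeg 1≤n 1≤k)

  B-nonNeg : ∀ {n k} → 1 ℕ.≤ k → k ℕ.≤ n → 0ℝ ≲ B n k
  B-nonNeg 1≤k k≤n = ^-nonNeg l (b.nonNeg 1≤k k≤n)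

  A-exchange : ∀ {m n j k} → 1 ℕ.≤ m → 1 ℕ.≤ j → m ℕ.≤ n → j ℕ.≤ k →
    A m j * A n (suc k) ≲ A m (suc j) * A n k
  A-exchange {n = n} {k = k} 1≤m 1≤j m≤n j≤k = ^-mono-product l
    (a.nonNeg 1≤m 1≤j) (a.nonNeg {n} {suc k} (ℕ.≤-trans 1≤m m≤n) (s≤s z≤n)) (a.exchange m≤n j≤k)

  B-exchange : ∀ {m n j k} → 1 ℕ.≤ k → suc j ℕ.≤ m → m ℕ.≤ n → m ℕ.+ k ℕ.≤ n ℕ.+ j →
    B m (suc j) * B n k ≲ B m j * B n (suc k)
  B-exchange {m} {n} {j} {k} 1≤k j<m m≤n m+k≤n+j = ^-mono-product l
    (b.nonNeg (s≤s z≤n) j<m) (b.nonNeg 1≤k k≤n) (b.exchange m≤n m+k≤n+j)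
    where
    k≤n : k ℕ.≤ n
    k≤n = ℕ.+-cancelˡ-≤ m k n (ℕ.≤-trans m+k≤n+j
      (ℕ.≤-trans (ℕ.+-monoʳ-≤ n (ℕ.<⇒≤ j<m)) (ℕ.≤-reflexive (ℕ.+-comm n m))))

  AB-exchange : ∀ {n k} → 1 ℕ.≤ k → 2 ℕ.+ k ℕ.≤ n →
    A n k * B n (2 ℕ.+ k) ≲ A n (suc k) * B n (suc k)
  AB-exchange {n} {k} 1≤k k<n = *-mono-≲ (A-nonNeg 1≤n 1≤k) (B-nonNeg (s≤s z≤n) k<n)
    (^-mono-≲ l (a.nonNeg 1≤n 1≤k) (a.mono n k))
    (^-mono-≲ l (b.nonNeg (s≤s z≤n) k<n) (b.antitone n (suc k)))
    where
    1≤n : 1 ℕ.≤ n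
    1≤n = ℕ.≤-trans (s≤s z≤n) k<n

  U-nonPositive-column : ∀ n k → ¬ (1ℤ ℤ.≤ k) → U n k ≡ 0ℝ
  U-nonPositive-column zero          k k<1 = refl
  U-nonPositive-column (suc zero)    k k<1 = if-no (k ℤ.≟ 1ℤ) λ { refl → k<1 ℤ.≤-refl }
  U-nonPositive-column (suc (suc n)) k k<1 =
    if-no ((1ℤ ℤ.≤? k) ×-dec (k ℤ.≤? + suc (suc n))) λ (1≤k , _) → k<1 1≤k

  t-column-0 : ∀ n → t n 0 ≡ 0ℝ
  t-column-0 n = U-nonPositive-column n (+ 0) λ { (ℤ.+≤+ ()) }

  t-above-diagonal : ∀ {n k} → n ℕ.< k → t n k ≡ 0ℝ
  t-above-diagonal {zero}          n<k = refl
  t-above-diagonal {suc zero}  {k} n<k = if-no (+ k ℤ.≟ 1ℤ) λ { refl → ℕ.<-irrefl refl n<k }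
  t-above-diagonal {suc (suc n)} {k} n<k =
    if-no ((1ℤ ℤ.≤? + k) ×-dec (+ k ℤ.≤? + suc (suc n))) λ { (_ , ℤ.+≤+ k≤n) → ℕ.<⇒≱ n<k k≤n }

  t-recurrence : ∀ {n k} → suc k ℕ.≤ 2 ℕ.+ n →
    t (2 ℕ.+ n) (suc k) ≡
      A (2 ℕ.+ n) (suc k) * t (suc n) (suc k) + B (2 ℕ.+ n) (suc k) * t (suc n) k
  t-recurrence {n} {k} k<n =
    if-yes ((1ℤ ℤ.≤? + suc k) ×-dec (+ suc k ℤ.≤? + suc (suc n))) (ℤ.+≤+ (s≤s z≤n) , ℤ.+≤+ k<n)

  -- `B-nonNeg` only covers columns up to the diagonal, so the entries beyond it are handled as
  -- zeros.
  t-step-nonNeg : ∀ m k → (∀ k → 0ℝ ≲ t (suc m) k) → Dec (suc k ℕ.≤ 2 ℕ.+ m) →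
    0ℝ ≲ t (2 ℕ.+ m) (suc k)
  t-step-nonNeg m k ih (yes k<n) = subst (0ℝ ≲_) (sym (t-recurrence {m} {k} k<n))
    (+-nonNeg (*-nonNeg (A-nonNeg {2 ℕ.+ m} {suc k} (s≤s z≤n) (s≤s z≤n)) (ih (suc k)))
              (*-nonNeg (B-nonNeg {2 ℕ.+ m} {suc k} (s≤s z≤n) k<n) (ih k)))
  t-step-nonNeg m k ih (no k≮n) =
    ≲-reflexive (sym (t-above-diagonal {2 ℕ.+ m} {suc k} (ℕ.≰⇒> k≮n)))

  t-nonNeg : ∀ n k → 0ℝ ≲ t n k
  t-nonNeg zero          k = ≲-refl
  t-nonNeg (suc zero)    k with + k ℤ.≟ 1ℤ
  ... | yes _ = 1-nonNeg
  ... | no  _ = ≲-refl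
  t-nonNeg (suc (suc m)) zero    = ≲-reflexive (sym (t-column-0 (2 ℕ.+ m)))
  t-nonNeg (suc (suc m)) (suc k) =
    t-step-nonNeg m k (t-nonNeg (suc m)) (suc k ℕ.≤? 2 ℕ.+ m)

  open Triangle A B t A-nonNeg B-nonNeg A-exchange B-exchange AB-exchange
    t-nonNeg t-column-0 t-above-diagonal t-recurrence using (log-concave)

  outside : ∀ k → ¬ (1ℤ ℤ.≤ k) → ¬ (1ℤ ℤ.≤ k ℤ.- 1ℤ) →
    U n (k ℤ.- 1ℤ) * U n (k ℤ.+ 1ℤ) ≲ U n k ^ 2
  outside k k<1 k<2 = ≲-trans
    (≈⇒≲ λ m → trans
      (cong (λ x → seq x m ℚ.* seq (U n (k ℤ.+ 1ℤ)) m) (U-nonPositive-column n (k ℤ.- 1ℤ) k<2))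
      (ℚ.*-zeroˡ (seq (U n (k ℤ.+ 1ℤ)) m)))
    (^-nonNeg 2 (≲-reflexive (sym (U-nonPositive-column n k k<1))))
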